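{- For $n\ge 0$ let $B_n$ be the set of inversion sequences $e\in\mathbf{I}_n$ for which there are no indices $i<j<k$ with $e_i>e_j<e_k$. Then $$\sum_{n\ge0}\sum_{e\in B_n}z^nt^{\mathrm{dist}(e)}=\frac{1+z(2-t)-z^2(1-t)-(1-z)\sqrt{(1+z-zt)^2-\frac{4z(1-z+zt)}{1-z}}}{2z(2-z)}.$$
   Context: An inversion sequence of length $n$ is an integer sequence $e=e_1\dots e_n$ with $0\le e_i<i$ for all $i$; $\mathbf{I}_n$ is the set of these, and $\mathbf{I}_0$ consists only of the empty sequence. For $e\in\mathbf{I}_n$, $\mathrm{dist}(e)=|\{e_1,\dots,e_n\}|$ is the number of distinct entries. In the paper's notation $B_n=\mathbf{I}_n(>,<,-)$. -}

module Defs where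

open import Data.Nat as ℕ using (ℕ; zero; suc; _∸_)
import Data.Nat.Properties as ℕP
open import Data.Integer as ℤ using (ℤ; +_; _+_; _*_; -_)
open import Data.Fin using (Fin; toℕ)
import Data.Fin as Fin
import Data.Fin.Properties as FinP
open import Data.Vec using (Vec; []; lookup; toList; _∷ʳ_)
open import Data.List using (List; [_]; concatMap; map; upTo; length; filter; deduplicate)
open import Data.Product using (Σ; ∃; _×_; _,_)
open import Relation.Nullary using (Dec; ¬_; ¬?)
open import Relation.Nullary.Decidable using (_×-dec_)
open import Relation.Binary.PropositionalEquality using (_≡_)

-- Inversion sequences.  A sequence e₁…eₙ is stored as a vector with
-- 0-based positions: position p (= i-1) holds eᵢ, with eᵢ < i, i.e. ≤ p.
-- invSeqs n enumerates I_n (each element exactly once): an element of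
-- I_{n+1} is an element of I_n extended by a last entry in {0,…,n}.

invSeqs : (n : ℕ) → List (Vec ℕ n)
invSeqs zero    = [ [] ]
invSeqs (suc n) = concatMap (λ e → map (e ∷ʳ_) (upTo (suc n))) (invSeqs n)

dist : ∀ {n} → Vec ℕ n → ℕ
dist e = length (deduplicate ℕP._≟_ (toList e))

HasPattern : ∀ {n} → Vec ℕ n → Set
HasPattern {n} e =
  ∃ λ (i : Fin n) → ∃ λ (j : Fin n) → ∃ λ (k : Fin n) →
    (i Fin.< j) × (j Fin.< k) ×
    (lookup e j ℕ.< lookup e i) × (lookup e j ℕ.< lookup e k)

hasPattern? : ∀ {n} (e : Vec ℕ n) → Dec (HasPattern e)
hasPattern? e =
  FinP.any? λ i → FinP.any? λ j → FinP.any? λ k →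
    (i Fin.<? j) ×-dec (j Fin.<? k) ×-dec
    (lookup e j ℕ.<? lookup e i) ×-dec (lookup e j ℕ.<? lookup e k)

InB : ∀ {n} → Vec ℕ n → Set
InB e = ¬ HasPattern e

inB? : ∀ {n} (e : Vec ℕ n) → Dec (InB e)
inB? e = ¬? (hasPattern? e)

coeffB : ℕ → ℕ → ℕ
coeffB n k = length (filter (λ e → inB? e ×-dec (dist e ℕP.≟ k)) (invSeqs n))

-- Formal power series in z,t with integer coefficients:
-- s n k is the coefficient of z^n t^k.

Series : Set
Series = ℕ → ℕ → ℤ

infix 4 _≗ₛ_
_≗ₛ_ : Series → Series → Set
f ≗ₛ g = ∀ n k → f n k ≡ g n k

sumTo : ℕ → (ℕ → ℤ) → ℤ
sumTo zero    h = + 0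
sumTo (suc m) h = sumTo m h + h m

infixl 6 _⊕_ _⊖_
infixl 7 _⊛_

_⊕_ : Series → Series → Series
(f ⊕ g) n k = f n k + g n k

⊝_ : Series → Series
(⊝ f) n k = - f n k

_⊖_ : Series → Series → Series
f ⊖ g = f ⊕ (⊝ g)

_⊛_ : Series → Series → Series
(f ⊛ g) n k = sumTo (suc n) λ i → sumTo (suc k) λ j → f i j * g (n ∸ i) (k ∸ j)

const : ℤ → Series
const c zero zero = c
const c _    _    = + 0

Z : Series
Z (suc zero) zero = + 1
Z _          _    = + 0

T : Series
T zero (suc zero) = + 1
T _    _          = + 0

FB : Series
FB n k = + coeffB n k

numP : Series
numP = const (+ 1) ⊕ Z ⊛ (const (+ 2) ⊖ T) ⊖ Z ⊛ Z ⊛ (const (+ 1) ⊖ T)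

-- Q = (1-z)² · ((1+z-zt)² - 4z(1-z+zt)/(1-z))
--   = (1-z)²(1+z-zt)² - 4z(1-z)(1-z+zt)
radQ : Series
radQ = (const (+ 1) ⊖ Z) ⊛ (const (+ 1) ⊖ Z)
         ⊛ (const (+ 1) ⊕ Z ⊖ Z ⊛ T) ⊛ (const (+ 1) ⊕ Z ⊖ Z ⊛ T)
       ⊖ const (+ 4) ⊛ Z ⊛ (const (+ 1) ⊖ Z) ⊛ (const (+ 1) ⊖ Z ⊕ Z ⊛ T)

denom : Series
denom = const (+ 2) ⊛ Z ⊛ (const (+ 2) ⊖ Z)

{-# OPTIONS --safe #-}

-- A sequence avoids the pattern iff no descent is followed by an ascent. Relax
-- the bound to eᵢ < i + h; let F_h be the resulting generating function, N_h
-- that of the zero-free sequences, so that N_0 = 1 and N_{h+1} = F_h (subtract 1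
-- from every entry). Removing a first 0, or else a last 0, from a sequence that
-- contains 0 gives N_{h+1} = N_h + P_h + R_h with
--   P_h = z (t N_{h+1} + N_{h+2} - N_{h+1}),   R_h = z (t (N_h - 1) + R_h).
-- Hence w_h = (2-z) N_h - 1 satisfies a homogeneous three-term linear recurrence,
-- whose solutions in power series are determined by their term at h = 0. Both
-- w_1 w_h and w_0 w_{h+1} are solutions, so w is geometric: w_1² = (1-z) w_2.
-- Eliminating w_2 by the recurrence leaves a quadratic equation for F_0 = N_1.
module Submission where

open import Defs
open import Algebra.Bundles using (CommutativeRing; RawRing)
import Algebra.Morphism.RingMonomorphism as RingMono
open import Algebra.Morphism.Structures using (IsRingMonomorphism)
import Algebra.Solver.Ring as RingSolver
open import Algebra.Solver.Ring.AlmostCommutativeRing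
  using (fromCommutativeRing; _-Raw-AlmostCommutative⟶_; Induced-equivalence)
open import Data.Empty using (⊥)
open import Data.Fin as Fin using (Fin)
open import Data.Integer as ℤ using (ℤ; +_; -[1+_])
import Data.Integer.Properties as ℤP
open import Data.List as List
  using (List; []; _∷_; _++_; _∷ʳ_; [_]; length; map; filter; upTo; deduplicate;
         cartesianProductWith; initLast; _∷ʳ′_)
open import Data.List.Membership.DecPropositional using () renaming (_∈?_ to member?)
open import Data.List.Membership.Propositional using (_∈_; _∉_)
open import Data.List.Membership.Propositional.Properties
open import Data.List.Membership.Propositional.Properties.WithK using (unique∧set⇒bag)
import Data.List.Properties as ListP
open import Data.List.Relation.Binary.BagAndSetEquality using (_∼[_]_; set; ∼bag⇒↭)
open import Data.List.Relation.Binary.Permutation.Propositional.Properties using (↭-length)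
open import Data.List.Relation.Unary.All as All using ()
open import Data.List.Relation.Unary.All.Properties using (¬Any⇒All¬)
open import Data.List.Relation.Unary.AllPairs using ([]; _∷_)
open import Data.List.Relation.Unary.Any as Any using (Any; here; there)
import Data.List.Relation.Unary.Any.Properties as AnyP
open import Data.List.Relation.Unary.Unique.DecPropositional.Properties using (deduplicate-!)
open import Data.List.Relation.Unary.Unique.Propositional using (Unique)
import Data.List.Relation.Unary.Unique.Propositional.Properties as UniqueP
open import Data.Maybe using (just; nothing)
open import Data.Nat as ℕ using (ℕ; zero; suc; _∸_; _≤_; _<_; z≤n; s≤s; s<s; z<s)
import Data.Nat.Properties as ℕP
open import Data.Product using (∃; _×_; _,_; proj₁; proj₂)
open import Data.Sum as Sum using (_⊎_; inj₁; inj₂)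
open import Data.Vec as Vec using (Vec; []; _∷_; lookup; toList)
import Data.Vec.Properties as VecP
open import Function using (_∘_; mk⇔; Equivalence)
open import Level using (0ℓ)
open import Relation.Binary.Definitions using (WeaklyDecidable)
open import Relation.Binary.PropositionalEquality
  using (_≡_; refl; sym; trans; cong; cong₂; subst; module ≡-Reasoning)
open import Relation.Nullary using (¬_; Dec; yes; no; contradiction)
open import Relation.Nullary.Decidable using (_×-dec_)

-- Power series

module PowerSeries {c ℓ} (R : CommutativeRing c ℓ) where

  private module R = CommutativeRing R
  open R using (Carrier; _≈_; 0#; 1#) renaming (_+_ to _+ᴿ_; _*_ to _*ᴿ_; -_ to -ᴿ_)
  open import Relation.Binary.Reasoning.Setoid R.setoid
  open import Algebra.Properties.CommutativeSemigroup R.+-commutativeSemigroup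
    using (interchange)

  ∑ : ℕ → (ℕ → Carrier) → Carrier
  ∑ zero    h = 0#
  ∑ (suc m) h = ∑ m h +ᴿ h m

  ∑-cong : ∀ m {f g : ℕ → Carrier} → (∀ i → i < m → f i ≈ g i) → ∑ m f ≈ ∑ m g
  ∑-cong zero    f≈g = R.refl
  ∑-cong (suc m) f≈g =
    R.+-cong (∑-cong m λ i i<m → f≈g i (ℕP.m<n⇒m<1+n i<m)) (f≈g m ℕP.≤-refl)

  ∑-zero : ∀ m {f : ℕ → Carrier} → (∀ i → i < m → f i ≈ 0#) → ∑ m f ≈ 0#
  ∑-zero zero    f≈0 = R.refl
  ∑-zero (suc m) f≈0 = R.trans
    (R.+-cong (∑-zero m λ i i<m → f≈0 i (ℕP.m<n⇒m<1+n i<m)) (f≈0 m ℕP.≤-refl))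
    (R.+-identityˡ 0#)

  ∑-head : ∀ m (f : ℕ → Carrier) → ∑ (suc m) f ≈ f 0 +ᴿ ∑ m (λ i → f (suc i))
  ∑-head zero    f = R.+-comm 0# (f 0)
  ∑-head (suc m) f = R.trans (R.+-congʳ (∑-head m f)) (R.+-assoc _ _ _)

  PS : Set c
  PS = ℕ → Carrier

  infix  4 _≋_
  infixl 6 _⊞_
  infixl 7 _⊠_

  _≋_ : PS → PS → Set ℓ
  f ≋ g = ∀ n → f n ≈ g n

  _⊞_ _⊠_ : PS → PS → PS
  (f ⊞ g) n = f n +ᴿ g n
  (f ⊠ g) n = ∑ (suc n) λ i → f i *ᴿ g (n ∸ i)

  ⊟_ : PS → PS
  (⊟ f) n = -ᴿ f n

  C : Carrier → PS
  C a zero    = a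
  C a (suc n) = 0#

  X : PS
  X zero    = 0#
  X (suc n) = C 1# n

  tail : PS → PS
  tail f n = f (suc n)

  ⊠-cong : ∀ {f f′ g g′} → f ≋ f′ → g ≋ g′ → f ⊠ g ≋ f′ ⊠ g′
  ⊠-cong f≋f′ g≋g′ n = ∑-cong (suc n) λ i _ → R.*-cong (f≋f′ i) (g≋g′ (n ∸ i))

  ⊠-zero : ∀ f g → (f ⊠ g) 0 ≈ f 0 *ᴿ g 0
  ⊠-zero f g = R.+-identityˡ _

  ⊠-sucˡ : ∀ f g n → (f ⊠ g) (suc n) ≈ f 0 *ᴿ g (suc n) +ᴿ (tail f ⊠ g) n
  ⊠-sucˡ f g n = ∑-head (suc n) _

  ⊠-sucʳ : ∀ f g n → (f ⊠ g) (suc n) ≈ (f ⊠ tail g) n +ᴿ f (suc n) *ᴿ g 0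
  ⊠-sucʳ f g n = R.+-cong
    -- Truncated subtraction gives `suc n ∸ i ≡ suc (n ∸ i)` only for `i ≤ n`; the bound supplied by
    -- `∑-cong` enters here.
    (∑-cong (suc n) λ { i (s≤s i≤n) →
      R.*-congˡ (R.reflexive (cong g (ℕP.+-∸-assoc 1 i≤n))) })
    (R.*-congˡ (R.reflexive (cong g (ℕP.n∸n≡0 n))))

  -- Splitting off the first summand of `f ⊠ g` and the last of `g ⊠ f` removes the same product and
  -- leaves the claim for `tail f` and `g` one degree lower. This replaces a reversal of the sum.
  ⊠-comm : ∀ f g → f ⊠ g ≋ g ⊠ f
  ⊠-comm f g zero    = R.+-congˡ (R.*-comm _ _)
  ⊠-comm f g (suc n) = begin
    (f ⊠ g) (suc n)                    ≈⟨ ⊠-sucˡ f g n ⟩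
    f 0 *ᴿ g (suc n) +ᴿ (tail f ⊠ g) n ≈⟨ R.+-comm _ _ ⟩
    (tail f ⊠ g) n +ᴿ f 0 *ᴿ g (suc n) ≈⟨ R.+-cong (⊠-comm (tail f) g n) (R.*-comm _ _) ⟩
    (g ⊠ tail f) n +ᴿ g (suc n) *ᴿ f 0 ≈⟨ ⊠-sucʳ g f n ⟨
    (g ⊠ f) (suc n)                    ∎

  ⊠-distribʳ : ∀ h f g → (f ⊞ g) ⊠ h ≋ f ⊠ h ⊞ g ⊠ h
  ⊠-distribʳ h f g n = go (suc n)
    where
    go : ∀ m → ∑ m (λ i → (f i +ᴿ g i) *ᴿ h (n ∸ i)) ≈
               ∑ m (λ i → f i *ᴿ h (n ∸ i)) +ᴿ ∑ m (λ i → g i *ᴿ h (n ∸ i))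
    go zero    = R.sym (R.+-identityˡ 0#)
    go (suc m) = R.trans (R.+-cong (go m) (R.distribʳ _ _ _)) (interchange _ _ _ _)

  ⊠-scaleˡ : ∀ a f g n → ((λ i → a *ᴿ f i) ⊠ g) n ≈ a *ᴿ (f ⊠ g) n
  ⊠-scaleˡ a f g n = go (suc n)
    where
    go : ∀ m → ∑ m (λ i → (a *ᴿ f i) *ᴿ g (n ∸ i)) ≈ a *ᴿ ∑ m (λ i → f i *ᴿ g (n ∸ i))
    go zero    = R.sym (R.zeroʳ a)
    go (suc m) = R.trans (R.+-cong (go m) (R.*-assoc _ _ _)) (R.sym (R.distribˡ _ _ _))

  -- Induction on the degree replaces an exchange of double sums: `tail (f ⊠ g)` is `f 0` times
  -- `tail g` plus `tail f ⊠ g`, and the induction hypothesis applies to `tail f`.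
  ⊠-assoc : ∀ f g h → (f ⊠ g) ⊠ h ≋ f ⊠ (g ⊠ h)
  ⊠-assoc f g h zero = begin
    ((f ⊠ g) ⊠ h) 0       ≈⟨ ⊠-zero (f ⊠ g) h ⟩
    (f ⊠ g) 0 *ᴿ h 0      ≈⟨ R.*-congʳ (⊠-zero f g) ⟩
    f 0 *ᴿ g 0 *ᴿ h 0     ≈⟨ R.*-assoc _ _ _ ⟩
    f 0 *ᴿ (g 0 *ᴿ h 0)   ≈⟨ R.*-congˡ (⊠-zero g h) ⟨
    f 0 *ᴿ (g ⊠ h) 0      ≈⟨ ⊠-zero f (g ⊠ h) ⟨
    (f ⊠ (g ⊠ h)) 0       ∎
  ⊠-assoc f g h (suc n) = begin
    ((f ⊠ g) ⊠ h) (suc n)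
      ≈⟨ ⊠-sucˡ (f ⊠ g) h n ⟩
    (f ⊠ g) 0 *ᴿ h (suc n) +ᴿ (tail (f ⊠ g) ⊠ h) n
      ≈⟨ R.+-cong
           (R.trans (R.*-congʳ (⊠-zero f g)) (R.*-assoc _ _ _))
           (R.trans (⊠-cong {g = h} (⊠-sucˡ f g) (λ _ → R.refl) n)
             (R.trans (⊠-distribʳ h (λ i → f 0 *ᴿ tail g i) (tail f ⊠ g) n)
               (R.+-cong (⊠-scaleˡ (f 0) (tail g) h n) (⊠-assoc (tail f) g h n)))) ⟩
    f 0 *ᴿ (g 0 *ᴿ h (suc n)) +ᴿ (f 0 *ᴿ (tail g ⊠ h) n +ᴿ (tail f ⊠ (g ⊠ h)) n)
      ≈⟨ R.+-assoc _ _ _ ⟨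
    f 0 *ᴿ (g 0 *ᴿ h (suc n)) +ᴿ f 0 *ᴿ (tail g ⊠ h) n +ᴿ (tail f ⊠ (g ⊠ h)) n
      ≈⟨ R.+-congʳ (R.distribˡ _ _ _) ⟨
    f 0 *ᴿ (g 0 *ᴿ h (suc n) +ᴿ (tail g ⊠ h) n) +ᴿ (tail f ⊠ (g ⊠ h)) n
      ≈⟨ R.+-congʳ (R.*-congˡ (⊠-sucˡ g h n)) ⟨
    f 0 *ᴿ (g ⊠ h) (suc n) +ᴿ (tail f ⊠ (g ⊠ h)) n
      ≈⟨ ⊠-sucˡ f (g ⊠ h) n ⟨
    (f ⊠ (g ⊠ h)) (suc n) ∎

  ⊠-vanishing : ∀ f g n → (∀ i → i ≤ n → g i ≈ 0#) → (f ⊠ g) n ≈ 0#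
  ⊠-vanishing f g n g≈0 = ∑-zero (suc n) λ i _ →
    R.trans (R.*-congˡ (g≈0 (n ∸ i) (ℕP.m∸n≤m n i))) (R.zeroʳ _)

  ⊠-zeroˡ : ∀ f n → ((λ _ → 0#) ⊠ f) n ≈ 0#
  ⊠-zeroˡ f n = ∑-zero (suc n) λ i _ → R.zeroˡ _

  C-⊠ : ∀ a f n → (C a ⊠ f) n ≈ a *ᴿ f n
  C-⊠ a f zero    = ⊠-zero (C a) f
  C-⊠ a f (suc n) = R.trans (⊠-sucˡ (C a) f n)
    (R.trans (R.+-congˡ (⊠-zeroˡ f n)) (R.+-identityʳ _))

  X-⊠-zero : ∀ f → (X ⊠ f) 0 ≈ 0#
  X-⊠-zero f = R.trans (⊠-zero X f) (R.zeroˡ _)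

  X-⊠-suc : ∀ f n → (X ⊠ f) (suc n) ≈ f n
  X-⊠-suc f n = begin
    (X ⊠ f) (suc n)                  ≈⟨ ⊠-sucˡ X f n ⟩
    0# *ᴿ f (suc n) +ᴿ (C 1# ⊠ f) n  ≈⟨ R.+-cong (R.zeroˡ _) (C-⊠ 1# f n) ⟩
    0# +ᴿ 1# *ᴿ f n                  ≈⟨ R.+-identityˡ _ ⟩
    1# *ᴿ f n                        ≈⟨ R.*-identityˡ _ ⟩
    f n                              ∎

  ⊠-identityˡ : ∀ f → C 1# ⊠ f ≋ f
  ⊠-identityˡ f n = R.trans (C-⊠ 1# f n) (R.*-identityˡ _)

  ring : CommutativeRing c ℓ
  ring = record
    { Carrier = PS ; _≈_ = _≋_ ; _+_ = _⊞_ ; _*_ = _⊠_ ; -_ = ⊟_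
    ; 0# = λ _ → 0# ; 1# = C 1#
    ; isCommutativeRing = record
      { isRing = record
        { +-isAbelianGroup = record
          { isGroup = record
            { isMonoid = record
              { isSemigroup = record
                { isMagma = record
                  { isEquivalence = record
                    { refl = λ _ → R.refl
                    ; sym = λ p n → R.sym (p n)
                    ; trans = λ p q n → R.trans (p n) (q n) }
                  ; ∙-cong = λ p q n → R.+-cong (p n) (q n) }
                ; assoc = λ f g h n → R.+-assoc _ _ _ }
              ; identity = (λ f n → R.+-identityˡ _) , (λ f n → R.+-identityʳ _) }
            ; inverse = (λ f n → R.-‿inverseˡ _) , (λ f n → R.-‿inverseʳ _)
            ; ⁻¹-cong = λ p n → R.-‿cong (p n) }
          ; comm = λ f g n → R.+-comm _ _ }
        ; *-cong = ⊠-cong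
        ; *-assoc = ⊠-assoc
        ; *-identity = ⊠-identityˡ , λ f n → R.trans (⊠-comm f (C 1#) n) (⊠-identityˡ f n)
        ; distrib = (λ h f g n → R.trans (⊠-comm h (f ⊞ g) n)
                       (R.trans (⊠-distribʳ h f g n)
                         (R.+-cong (⊠-comm f h n) (⊠-comm g h n))))
                  , ⊠-distribʳ }
      ; *-comm = ⊠-comm } }

-- Formal power series in z and t as the ring ℤ⟦t⟧⟦z⟧

module ℤ⟦t⟧ = PowerSeries ℤP.+-*-commutativeRing
module ℤ⟦t⟧⟦z⟧ = PowerSeries ℤ⟦t⟧.ring

sumTo≡∑ : ∀ m h → sumTo m h ≡ ℤ⟦t⟧.∑ m h
sumTo≡∑ zero    h = refl
sumTo≡∑ (suc m) h = cong (ℤ._+ h m) (sumTo≡∑ m h)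

∑-coeff : ∀ m (h : ℕ → ℕ → ℤ) k → ℤ⟦t⟧⟦z⟧.∑ m h k ≡ ℤ⟦t⟧.∑ m (λ i → h i k)
∑-coeff zero    h k = refl
∑-coeff (suc m) h k = cong (ℤ._+ h m k) (∑-coeff m h k)

-- The double sum is a convolution in z whose coefficients are multiplied by convolution in t. The
-- ring laws for `⊛` therefore come from `PowerSeries` applied twice.
⊛≗⊠ : ∀ f g → f ⊛ g ≗ₛ f ℤ⟦t⟧⟦z⟧.⊠ g
⊛≗⊠ f g n k = begin
  (f ⊛ g) n k
    ≡⟨ sumTo≡∑ (suc n) _ ⟩
  ℤ⟦t⟧.∑ (suc n) (λ i → sumTo (suc k) λ j → f i j ℤ.* g (n ∸ i) (k ∸ j))
    ≡⟨ ℤ⟦t⟧.∑-cong (suc n) (λ i _ → sumTo≡∑ (suc k) _) ⟩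
  ℤ⟦t⟧.∑ (suc n) (λ i → (f i ℤ⟦t⟧.⊠ g (n ∸ i)) k)
    ≡⟨ ∑-coeff (suc n) (λ i → f i ℤ⟦t⟧.⊠ g (n ∸ i)) k ⟨
  (f ℤ⟦t⟧⟦z⟧.⊠ g) n k ∎
  where open ≡-Reasoning

const≗C : ∀ a → const a ≗ₛ ℤ⟦t⟧⟦z⟧.C (ℤ⟦t⟧.C a)
const≗C a zero    zero    = refl
const≗C a zero    (suc k) = refl
const≗C a (suc n) k       = refl

Z≗X : Z ≗ₛ ℤ⟦t⟧⟦z⟧.X
Z≗X zero          k       = refl
Z≗X (suc zero)    zero    = refl
Z≗X (suc zero)    (suc k) = refl
Z≗X (suc (suc n)) k       = refl

T≗CX : T ≗ₛ ℤ⟦t⟧⟦z⟧.C ℤ⟦t⟧.X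
T≗CX zero    zero          = refl
T≗CX zero    (suc zero)    = refl
T≗CX zero    (suc (suc k)) = refl
T≗CX (suc n) k             = refl

0ₛ : Series
0ₛ _ _ = + 0

seriesRawRing : RawRing _ _
seriesRawRing = record
  { Carrier = Series ; _≈_ = _≗ₛ_ ; _+_ = _⊕_ ; _*_ = _⊛_ ; -_ = ⊝_
  ; 0# = 0ₛ ; 1# = const (+ 1) }

-- Carrier and equality coincide and the identity respects the operations, so the ring laws pull
-- back along it. The resulting `seriesRing` has `⊕`, `⊛` and `const` themselves as its operations.
id-isRingMonomorphism :
  IsRingMonomorphism seriesRawRing (CommutativeRing.rawRing ℤ⟦t⟧⟦z⟧.ring) (λ f → f)
id-isRingMonomorphism = record
  { isRingHomomorphism = record
    { isSemiringHomomorphism = record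
      { isNearSemiringHomomorphism = record
        { +-isMonoidHomomorphism = record
          { isMagmaHomomorphism = record
            { isRelHomomorphism = record { cong = λ p → p }
            ; homo = λ f g n k → refl }
          ; ε-homo = λ n k → refl }
        ; *-homo = ⊛≗⊠ }
      ; 1#-homo = const≗C (+ 1) }
    ; -‿homo = λ f n k → refl }
  ; injective = λ p → p }

seriesRing : CommutativeRing _ _
seriesRing = record
  { RawRing seriesRawRing
  ; isCommutativeRing = RingMono.isCommutativeRing id-isRingMonomorphism
      (CommutativeRing.isCommutativeRing ℤ⟦t⟧⟦z⟧.ring) }

module S = CommutativeRing seriesRing

const-* : ∀ a b → const (a ℤ.* b) ≗ₛ const a ⊛ const b
const-* a b n k = begin
  const (a ℤ.* b) n k                                    ≡⟨ const≗C (a ℤ.* b) n k ⟩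
  ℤ⟦t⟧⟦z⟧.C (ℤ⟦t⟧.C (a ℤ.* b)) n k                       ≡⟨ lemma n k ⟩
  (ℤ⟦t⟧.C a ℤ⟦t⟧.⊠ ℤ⟦t⟧⟦z⟧.C (ℤ⟦t⟧.C b) n) k           ≡⟨ ℤ⟦t⟧⟦z⟧.C-⊠ (ℤ⟦t⟧.C a) (ℤ⟦t⟧⟦z⟧.C (ℤ⟦t⟧.C b)) n k ⟨
  (ℤ⟦t⟧⟦z⟧.C (ℤ⟦t⟧.C a) ℤ⟦t⟧⟦z⟧.⊠ ℤ⟦t⟧⟦z⟧.C (ℤ⟦t⟧.C b)) n k
    ≡⟨ ℤ⟦t⟧⟦z⟧.⊠-cong {f = const a} {g = const b} (const≗C a) (const≗C b) n k ⟨
  (const a ℤ⟦t⟧⟦z⟧.⊠ const b) n k                      ≡⟨ ⊛≗⊠ (const a) (const b) n k ⟨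
  (const a ⊛ const b) n k                              ∎
  where
  open ≡-Reasoning
  lemma : ∀ n k → ℤ⟦t⟧⟦z⟧.C (ℤ⟦t⟧.C (a ℤ.* b)) n k ≡
                  (ℤ⟦t⟧.C a ℤ⟦t⟧.⊠ ℤ⟦t⟧⟦z⟧.C (ℤ⟦t⟧.C b) n) k
  lemma zero    zero    = sym (ℤ⟦t⟧.C-⊠ a (ℤ⟦t⟧.C b) zero)
  lemma zero    (suc k) = sym (trans (ℤ⟦t⟧.C-⊠ a (ℤ⟦t⟧.C b) (suc k)) (ℤP.*-zeroʳ a))
  lemma (suc n) k       = sym (trans (ℤ⟦t⟧.C-⊠ a (λ _ → + 0) k) (ℤP.*-zeroʳ a))

const-+ : ∀ a b → const (a ℤ.+ b) ≗ₛ const a ⊕ const b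
const-+ a b zero    zero    = refl
const-+ a b zero    (suc k) = refl
const-+ a b (suc n) k       = refl

const-neg : ∀ a → const (ℤ.- a) ≗ₛ ⊝ const a
const-neg a zero    zero    = refl
const-neg a zero    (suc k) = refl
const-neg a (suc n) k       = refl

const-0 : const (+ 0) ≗ₛ 0ₛ
const-0 zero    zero    = refl
const-0 zero    (suc k) = refl
const-0 (suc n) k       = refl

-- Lets the ring solver take its coefficients in ℤ, where equality is decidable, and read them as
-- `const`.
constMorphism : CommutativeRing.rawRing ℤP.+-*-commutativeRing
                  -Raw-AlmostCommutative⟶ fromCommutativeRing seriesRing
constMorphism = record
  { ⟦_⟧ = const ; +-homo = const-+ ; *-homo = const-* ; -‿homo = const-neg
  ; 0-homo = const-0 ; 1-homo = λ n k → refl }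

-- Multiplication by z and t on coefficients, and z-adic order

Z-⊛-zero : ∀ f k → (Z ⊛ f) 0 k ≡ + 0
Z-⊛-zero f k = trans (⊛≗⊠ Z f 0 k)
  (trans (ℤ⟦t⟧⟦z⟧.⊠-cong {g = f} Z≗X (λ _ _ → refl) 0 k) (ℤ⟦t⟧⟦z⟧.X-⊠-zero f k))

Z-⊛-suc : ∀ f n k → (Z ⊛ f) (suc n) k ≡ f n k
Z-⊛-suc f n k = trans (⊛≗⊠ Z f (suc n) k)
  (trans (ℤ⟦t⟧⟦z⟧.⊠-cong {g = f} Z≗X (λ _ _ → refl) (suc n) k) (ℤ⟦t⟧⟦z⟧.X-⊠-suc f n k))

T-⊛ : ∀ f n k → (T ⊛ f) n k ≡ (ℤ⟦t⟧.X ℤ⟦t⟧.⊠ f n) k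
T-⊛ f n k = trans (⊛≗⊠ T f n k)
  (trans (ℤ⟦t⟧⟦z⟧.⊠-cong {g = f} T≗CX (λ _ _ → refl) n k) (ℤ⟦t⟧⟦z⟧.C-⊠ ℤ⟦t⟧.X f n k))

T-⊛-zero : ∀ f n → (T ⊛ f) n 0 ≡ + 0
T-⊛-zero f n = trans (T-⊛ f n 0) (ℤ⟦t⟧.X-⊠-zero (f n))

T-⊛-suc : ∀ f n k → (T ⊛ f) n (suc k) ≡ f n k
T-⊛-suc f n k = trans (T-⊛ f n (suc k)) (ℤ⟦t⟧.X-⊠-suc (f n) k)

-- f ∈ (zⁿ)
Vanishes : ℕ → Series → Set
Vanishes n f = ∀ m → m < n → ∀ k → f m k ≡ + 0

vanishes-⊕ : ∀ {n f g} → Vanishes n f → Vanishes n g → Vanishes n (f ⊕ g)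
vanishes-⊕ p q m m<n k = cong₂ ℤ._+_ (p m m<n k) (q m m<n k)

vanishes-⊛ : ∀ {n} f {g} → Vanishes n g → Vanishes n (f ⊛ g)
vanishes-⊛ f {g} p m m<n k = trans (⊛≗⊠ f g m k)
  (ℤ⟦t⟧⟦z⟧.⊠-vanishing f g m (λ i i≤m → p i (ℕP.≤-<-trans i≤m m<n)) k)

vanishes-Z⊛ : ∀ {n f} → Vanishes n f → Vanishes (suc n) (Z ⊛ f)
vanishes-Z⊛ {f = f} p zero    _         k = Z-⊛-zero f k
vanishes-Z⊛ {f = f} p (suc m) (s≤s m<n) k = trans (Z-⊛-suc f m k) (p m m<n k)

-- The recurrence for the refined generating functions

module Kernel
  (S : CommutativeRing 0ℓ 0ℓ)
  (morphism : CommutativeRing.rawRing ℤP.+-*-commutativeRing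
                -Raw-AlmostCommutative⟶ fromCommutativeRing S)
  (z t : CommutativeRing.Carrier S)
  where

  open CommutativeRing S
    using (_≈_; _+_; _*_; _-_; -_; 0#; +-group; +-cong; +-congˡ; +-identityˡ; +-identityʳ;
           *-congˡ; *-comm; zeroʳ)
    renaming (Carrier to A; refl to ≈-refl; trans to ≈-trans; reflexive to ≈-reflexive)
  open _-Raw-AlmostCommutative⟶_ morphism using () renaming (⟦_⟧ to κ)
  open import Algebra.Properties.Group +-group using ()
    renaming (x≈y⇒x∙y⁻¹≈ε to x≈y⇒x-y≈0; x∙y⁻¹≈ε⇒x≈y to x-y≈0⇒x≈y)

  κ-≟ : WeaklyDecidable (Induced-equivalence morphism)
  κ-≟ a b with a ℤP.≟ b
  ... | yes a≡b = just (≈-reflexive (cong κ a≡b))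
  ... | no _    = nothing

  open RingSolver (CommutativeRing.rawRing ℤP.+-*-commutativeRing)
    (fromCommutativeRing S) morphism κ-≟

  𝟏 𝟐 : A
  𝟏 = κ (+ 1)
  𝟐 = κ (+ 2)

  -- Eliminating P and R from the three equations leaves `defect (N h) (N (1 ℕ.+ h)) (N (2 ℕ.+ h))`
  -- equal to -z t. The factor `𝟏 - z` clears the denominator of R = z t (N - 1) / (1 - z).
  defect : A → A → A → A
  defect w₀ w₁ w₂ =
    (𝟏 - z) * ((𝟏 + z - z * t) * w₁ - z * w₂) - (𝟏 - z + z * t) * w₀

  defectᵖ : ∀ {n} → (z t w₀ w₁ w₂ : Polynomial n) → Polynomial n
  defectᵖ z t w₀ w₁ w₂ =
    (con (+ 1) :- z) :* ((con (+ 1) :+ z :- z :* t) :* w₁ :- z :* w₂)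
      :- (con (+ 1) :- z :+ z :* t) :* w₀

  *-vanishʳ : ∀ a {x} → x ≈ 0# → a * x ≈ 0#
  *-vanishʳ a x≈0 = ≈-trans (*-congˡ x≈0) (zeroʳ a)

  +-vanish : ∀ {x y} → x ≈ 0# → y ≈ 0# → x + y ≈ 0#
  +-vanish x≈0 y≈0 = ≈-trans (+-cong x≈0 y≈0) (+-identityˡ 0#)

  -- Modulo z, `defect` is `w₁ - w₀`. Collecting the multiples of z brings a vanishing `defect` into
  -- the form that `contraction` asks for.
  defect-step : ∀ w₀ w₁ w₂ → w₁ ≈
    w₀ + z * ((t - 𝟏) * w₀ + (z + t - z * t) * w₁ + (𝟏 - z) * w₂) + defect w₀ w₁ w₂
  defect-step = solve 5 (λ z t w₀ w₁ w₂ →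
    w₁ := w₀ :+ z :* ((t :- con (+ 1)) :* w₀ :+ (z :+ t :- z :* t) :* w₁
                      :+ (con (+ 1) :- z) :* w₂) :+ defectᵖ z t w₀ w₁ w₂) ≈-refl z t

  module Geometric
    -- The one property of power series beyond the ring laws: by z-adic separation, a solution
    -- vanishes once its term at 0 does.
    (contraction : (D : ℕ → A) → D 0 ≈ 0# → (a b c : A) →
       (∀ h → D (1 ℕ.+ h) ≈ D h + z * (a * D h + b * D (1 ℕ.+ h) + c * D (2 ℕ.+ h))) →
       ∀ h → D h ≈ 0#)
    (N P R : ℕ → A)
    (N-zero : N 0 ≈ 𝟏)
    (N-suc : ∀ h → N (1 ℕ.+ h) ≈ N h + (P h + R h))
    (P-eq : ∀ h → P h + z * N (1 ℕ.+ h) ≈ z * (t * N (1 ℕ.+ h) + N (2 ℕ.+ h)))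
    (R-eq : ∀ h → R h + z * t ≈ z * (t * N h + R h))
    where

    -- On a constant sequence c, `defect` is -z t (2 - z) c, so 1 / (2 - z) is a particular solution
    -- of the recurrence for `N`. As 2 - z is not invertible over ℤ, the difference is scaled by it.
    w : ℕ → A
    w h = (𝟐 - z) * N h - 𝟏

    w-defect : ∀ h → defect (w h) (w (1 ℕ.+ h)) (w (2 ℕ.+ h)) ≈ 0#
    w-defect h = ≈-trans
      -- The multipliers carry out the elimination: with the common factor 1 - z, p cancels between
      -- the first two equations, and r cancels against the third, where its coefficient is 1 - z.
      (solve 7 (λ z t n₀ n₁ n₂ p r →
        let w = λ n → (con (+ 2) :- z) :* n :- con (+ 1) in
        defectᵖ z t (w n₀) (w n₁) (w n₂) :=
          (con (+ 2) :- z) :* (con (+ 1) :- z) :* (n₁ :- (n₀ :+ (p :+ r)))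
          :+ (con (+ 2) :- z) :* (con (+ 1) :- z) :* (p :+ z :* n₁ :- z :* (t :* n₁ :+ n₂))
          :+ (con (+ 2) :- z) :* (r :+ z :* t :- z :* (t :* n₀ :+ r)))
        ≈-refl z t (N h) (N (1 ℕ.+ h)) (N (2 ℕ.+ h)) (P h) (R h))
      (+-vanish (+-vanish
        (*-vanishʳ _ (x≈y⇒x-y≈0 (N-suc h)))
        (*-vanishʳ _ (x≈y⇒x-y≈0 (P-eq h))))
        (*-vanishʳ _ (x≈y⇒x-y≈0 (R-eq h))))

    -- The coefficients of the recurrence do not involve h, so the shift of `w` is again a solution,
    -- and so is `D`, a combination of the two with multipliers independent of h. Cross-multiplying
    -- makes `D 0` vanish by commutativity and avoids a division.
    w-geometric : ∀ h → w 1 * w h - w 0 * w (1 ℕ.+ h) ≈ 0#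
    w-geometric = contraction D (x≈y⇒x-y≈0 (*-comm (w 1) (w 0)))
      (t - 𝟏) (z + t - z * t) (𝟏 - z)
      λ h → ≈-trans (defect-step (D h) (D (1 ℕ.+ h)) (D (2 ℕ.+ h)))
        (≈-trans (+-congˡ (D-defect h)) (+-identityʳ _))
      where
      D : ℕ → A
      D h = w 1 * w h - w 0 * w (1 ℕ.+ h)
      D-defect : ∀ h → defect (D h) (D (1 ℕ.+ h)) (D (2 ℕ.+ h)) ≈ 0#
      D-defect h = ≈-trans
        (solve 8 (λ z t a b w₀ w₁ w₂ w₃ →
          defectᵖ z t (a :* w₀ :- b :* w₁) (a :* w₁ :- b :* w₂) (a :* w₂ :- b :* w₃) :=
            a :* defectᵖ z t w₀ w₁ w₂ :+ (:- b) :* defectᵖ z t w₁ w₂ w₃)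
          ≈-refl z t (w 1) (w 0) (w h) (w (1 ℕ.+ h)) (w (2 ℕ.+ h)) (w (3 ℕ.+ h)))
        (+-vanish (*-vanishʳ (w 1) (w-defect h)) (*-vanishʳ (- w 0) (w-defect (1 ℕ.+ h))))

    -- At the series ring, `p`, `d` and `q` unfold to `numP`, `denom` and `radQ`. The linear
    -- relation with `root` holds by definition, so the content is in `root²`.
    p d q root : A
    p = 𝟏 + z * (𝟐 - t) - z * z * (𝟏 - t)
    d = 𝟐 * z * (𝟐 - z)
    q = (𝟏 - z) * (𝟏 - z) * (𝟏 + z - z * t) * (𝟏 + z - z * t)
        - κ (+ 4) * z * (𝟏 - z) * (𝟏 - z + z * t)
    root = p - d * N 1

    -- Put b = (1 - z)(1 + z - z t) and c = (1 - z)(1 - z + z t). The relations for `w` give z (w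
    -- 1)² - b (w 1) + c = 0, with discriminant b² - 4 z c equal to `q`. Since `root` is b - 2 z (w
    -- 1), this is completing the square.
    root² : root * root ≈ q
    root² = x-y≈0⇒x≈y _ _ (≈-trans
      (solve 5 (λ z t n₀ n₁ n₂ →
        let 𝟙 = con (+ 1)
            𝟚 = con (+ 2)
            w = λ n → (𝟚 :- z) :* n :- 𝟙
            root = 𝟙 :+ z :* (𝟚 :- t) :- z :* z :* (𝟙 :- t) :- 𝟚 :* z :* (𝟚 :- z) :* n₁
        in root :* root
             :- ((𝟙 :- z) :* (𝟙 :- z) :* (𝟙 :+ z :- z :* t) :* (𝟙 :+ z :- z :* t)
                 :- con (+ 4) :* z :* (𝟙 :- z) :* (𝟙 :- z :+ z :* t))
           -- The summands are 4 z times z (w₁² - w₀ w₂), minus the defect, and the error of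
           -- replacing w₀ by 1 - z, because w₀ - (1 - z) = (2 - z)(n₀ - 1). The literal `-[1+ 3 ]`
           -- is -4.
           := con (+ 4) :* z :* z :* (w n₁ :* w n₁ :- w n₀ :* w n₂)
              :+ con -[1+ 3 ] :* z :* defectᵖ z t (w n₀) (w n₁) (w n₂)
              :+ con (+ 4) :* z :* (𝟚 :- z) :* (z :* w n₂ :- (𝟙 :- z :+ z :* t)) :* (n₀ :- 𝟙))
        ≈-refl z t (N 0) (N 1) (N 2))
      (+-vanish (+-vanish
        (*-vanishʳ _ (w-geometric 1))
        (*-vanishʳ _ (w-defect 0)))
        (*-vanishʳ _ (x≈y⇒x-y≈0 N-zero))))

    d*N₁≈p-root : d * N 1 ≈ p - root
    d*N₁≈p-root = solve 2 (λ p dn → dn := p :- (p :- dn)) ≈-refl p (d * N 1)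

-- Valley-free sequences

unique-set⇒length : ∀ {A : Set} {xs ys : List A} →
  Unique xs → Unique ys → xs ∼[ set ] ys → length xs ≡ length ys
unique-set⇒length xs! ys! xs∼ys = ↭-length (∼bag⇒↭ (unique∧set⇒bag xs! ys! xs∼ys))

-- Number of distinct entries

_∈?_ : ∀ x e → Dec (x ∈ e)
_∈?_ = member? ℕP._≟_

distinct : List ℕ → ℕ
distinct e = length (deduplicate ℕP._≟_ e)

dedup∼ : ∀ e → deduplicate ℕP._≟_ e ∼[ set ] e
dedup∼ e = mk⇔ (∈-deduplicate⁻ ℕP._≟_ e) (∈-deduplicate⁺ ℕP._≟_)

-- Any duplicate-free list with the same elements may serve for counting; the rules for `distinct`
-- below all reduce to this.
distinct-length : ∀ {e u} → Unique u → e ∼[ set ] u → distinct e ≡ length u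
distinct-length {e} u! e∼u = unique-set⇒length (deduplicate-! ℕP._≟_ e) u!
  (mk⇔ (Equivalence.to e∼u ∘ Equivalence.to (dedup∼ e))
       (Equivalence.from (dedup∼ e) ∘ Equivalence.from e∼u))

distinct-cong : ∀ {e e′} → e ∼[ set ] e′ → distinct e ≡ distinct e′
distinct-cong {e} {e′} e∼e′ = distinct-length (deduplicate-! ℕP._≟_ e′)
  (mk⇔ (Equivalence.from (dedup∼ e′) ∘ Equivalence.to e∼e′)
       (Equivalence.from e∼e′ ∘ Equivalence.to (dedup∼ e′)))

distinct-map-suc : ∀ e → distinct (map suc e) ≡ distinct e
distinct-map-suc e = trans
  (distinct-length (UniqueP.map⁺ ℕP.suc-injective (deduplicate-! ℕP._≟_ e)) (mk⇔
    (λ p → let y , y∈e , eq = ∈-map⁻ suc p in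
           subst (_∈ _) (sym eq) (∈-map⁺ suc (∈-deduplicate⁺ ℕP._≟_ y∈e)))
    (λ p → let y , y∈e , eq = ∈-map⁻ suc p in
           subst (_∈ _) (sym eq) (∈-map⁺ suc (∈-deduplicate⁻ ℕP._≟_ e y∈e)))))
  (ListP.length-map suc (deduplicate ℕP._≟_ e))

distinct-∷-∈ : ∀ {x e} → x ∈ e → distinct (x ∷ e) ≡ distinct e
distinct-∷-∈ x∈e = distinct-cong (mk⇔ (λ { (here refl) → x∈e ; (there p) → p }) there)

distinct-∷-∉ : ∀ {x e} → x ∉ e → distinct (x ∷ e) ≡ suc (distinct e)
distinct-∷-∉ {x} {e} x∉e = distinct-length
  (¬Any⇒All¬ _ (x∉e ∘ ∈-deduplicate⁻ ℕP._≟_ e) ∷ deduplicate-! ℕP._≟_ e)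
  (mk⇔ (λ { (here p) → here p ; (there p) → there (∈-deduplicate⁺ ℕP._≟_ p) })
       (λ { (here p) → here p ; (there p) → there (∈-deduplicate⁻ ℕP._≟_ e p) }))

distinct-∷ʳ : ∀ x e → distinct (e ∷ʳ x) ≡ distinct (x ∷ e)
distinct-∷ʳ x e = distinct-cong (mk⇔
  (λ p → Sum.[ there , (λ { (here q) → here q ; (there ()) }) ]′ (∈-++⁻ e p))
  (λ { (here p) → ∈-++⁺ʳ e (here p) ; (there p) → ∈-++⁺ˡ p }))

-- eᵢ ≤ h + i for the 0-based index i.
data Bounded : ℕ → List ℕ → Set where
  []  : ∀ {h} → Bounded h []
  _∷_ : ∀ {h x e} → x ≤ h → Bounded (suc h) e → Bounded h (x ∷ e)

bounded-map-suc⁺ : ∀ {h e} → Bounded h e → Bounded (suc h) (map suc e)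
bounded-map-suc⁺ []        = []
bounded-map-suc⁺ (x≤h ∷ b) = s≤s x≤h ∷ bounded-map-suc⁺ b

bounded-map-suc⁻ : ∀ {h} e → Bounded (suc h) (map suc e) → Bounded h e
bounded-map-suc⁻ []      []              = []
bounded-map-suc⁻ (_ ∷ e) (s≤s x≤h ∷ b) = x≤h ∷ bounded-map-suc⁻ e b

bounded-∷ʳ⁺ : ∀ {h e x} → Bounded h e → x ≤ h ℕ.+ length e → Bounded h (e ∷ʳ x)
bounded-∷ʳ⁺ {h} {x = x} []              x≤ = subst (x ≤_) (ℕP.+-identityʳ h) x≤ ∷ []
bounded-∷ʳ⁺ {h} {x = x} (_∷_ {e = e} y≤h b) x≤ =
  y≤h ∷ bounded-∷ʳ⁺ b (subst (x ≤_) (ℕP.+-suc h (length e)) x≤)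

bounded-∷ʳ⁻ : ∀ {h x} e → Bounded h (e ∷ʳ x) → Bounded h e × x ≤ h ℕ.+ length e
bounded-∷ʳ⁻ {h} []      (x≤h ∷ []) = [] , subst (_ ≤_) (sym (ℕP.+-identityʳ h)) x≤h
bounded-∷ʳ⁻ {h} {x} (y ∷ e) (y≤h ∷ b)  =
  let b′ , x≤ = bounded-∷ʳ⁻ e b
  in y≤h ∷ b′ , subst (x ≤_) (sym (ℕP.+-suc h (length e))) x≤

-- The pattern split by its first entry: `a` plays eᵢ and `b` plays eⱼ, at positions that need not
-- be adjacent. Recursion on the list suits the removal of a first or last entry.
DownUp : ℕ → List ℕ → Set
DownUp a []      = ⊥
DownUp a (b ∷ e) = (b < a × Any (b <_) e) ⊎ DownUp a e

Valley : List ℕ → Set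
Valley []      = ⊥
Valley (a ∷ e) = DownUp a e ⊎ Valley e

downUp-map-suc⁺ : ∀ {a} e → DownUp a e → DownUp (suc a) (map suc e)
downUp-map-suc⁺ (b ∷ e) (inj₁ (b<a , b<e)) = inj₁ (s<s b<a , AnyP.map⁺ (Any.map s<s b<e))
downUp-map-suc⁺ (b ∷ e) (inj₂ p)           = inj₂ (downUp-map-suc⁺ e p)

downUp-map-suc⁻ : ∀ {a} e → DownUp (suc a) (map suc e) → DownUp a e
downUp-map-suc⁻ (b ∷ e) (inj₁ (b<a , b<e)) =
  inj₁ (ℕP.≤-pred b<a , Any.map ℕP.≤-pred (AnyP.map⁻ b<e))
downUp-map-suc⁻ (b ∷ e) (inj₂ p)           = inj₂ (downUp-map-suc⁻ e p)

valley-map-suc⁺ : ∀ e → Valley e → Valley (map suc e)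
valley-map-suc⁺ (a ∷ e) (inj₁ p) = inj₁ (downUp-map-suc⁺ e p)
valley-map-suc⁺ (a ∷ e) (inj₂ p) = inj₂ (valley-map-suc⁺ e p)

valley-map-suc⁻ : ∀ e → Valley (map suc e) → Valley e
valley-map-suc⁻ (a ∷ e) (inj₁ p) = inj₁ (downUp-map-suc⁻ e p)
valley-map-suc⁻ (a ∷ e) (inj₂ p) = inj₂ (valley-map-suc⁻ e p)

¬downUp-zero : ∀ e → ¬ DownUp 0 e
¬downUp-zero (b ∷ e) (inj₁ (() , _))
¬downUp-zero (b ∷ e) (inj₂ p) = ¬downUp-zero e p

-- Nothing lies below 0, so a leading 0 is never the top of a descent.
valley-0∷⁻ : ∀ e → Valley (0 ∷ e) → Valley e
valley-0∷⁻ e (inj₁ p) = contradiction p (¬downUp-zero e)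
valley-0∷⁻ e (inj₂ p) = p

downUp-∷ʳ⁺ : ∀ {a x} e → DownUp a e → DownUp a (e ∷ʳ x)
downUp-∷ʳ⁺ (b ∷ e) (inj₁ (b<a , b<e)) = inj₁ (b<a , AnyP.++⁺ˡ b<e)
downUp-∷ʳ⁺ (b ∷ e) (inj₂ p)           = inj₂ (downUp-∷ʳ⁺ e p)

valley-∷ʳ⁺ : ∀ {x} e → Valley e → Valley (e ∷ʳ x)
valley-∷ʳ⁺ (a ∷ e) (inj₁ p) = inj₁ (downUp-∷ʳ⁺ e p)
valley-∷ʳ⁺ (a ∷ e) (inj₂ p) = inj₂ (valley-∷ʳ⁺ e p)

downUp-∷ʳ0⁻ : ∀ {a} e → DownUp a (e ∷ʳ 0) → DownUp a e
downUp-∷ʳ0⁻ []      (inj₁ (_ , ()))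
downUp-∷ʳ0⁻ (b ∷ e) (inj₁ (b<a , p)) with AnyP.++⁻ e p
... | inj₁ b<e         = inj₁ (b<a , b<e)
... | inj₂ (here ())
... | inj₂ (there ())
downUp-∷ʳ0⁻ (b ∷ e) (inj₂ p)         = inj₂ (downUp-∷ʳ0⁻ e p)

-- A final entry could only play eₖ, and 0 exceeds nothing.
valley-∷ʳ0⁻ : ∀ e → Valley (e ∷ʳ 0) → Valley e
valley-∷ʳ0⁻ []      (inj₁ ())
valley-∷ʳ0⁻ (a ∷ e) (inj₁ p) = inj₁ (downUp-∷ʳ0⁻ e p)
valley-∷ʳ0⁻ (a ∷ e) (inj₂ p) = inj₂ (valley-∷ʳ0⁻ e p)

-- A positive first entry, a 0 and a positive last entry form the pattern. Hence a valley-free list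
-- that contains 0 but starts positively ends in 0.
0∈⇒downUp : ∀ {x y} e → 0 ∈ e → DownUp (suc x) (e ∷ʳ suc y)
0∈⇒downUp (_ ∷ e) (here refl) = inj₁ (z<s , AnyP.++⁺ʳ e (here z<s))
0∈⇒downUp (_ ∷ e) (there p)   = inj₂ (0∈⇒downUp e p)

record Good (h n k : ℕ) (e : List ℕ) : Set where
  constructor good
  field
    bounded  : Bounded h e
    noValley : ¬ Valley e
    len      : length e ≡ n
    dist≡    : distinct e ≡ k

good-map-suc⁺ : ∀ {h n k e} → Good h n k e → Good (suc h) n k (map suc e)
good-map-suc⁺ {e = e} (good b v l d) = good (bounded-map-suc⁺ b) (v ∘ valley-map-suc⁻ e)
  (trans (ListP.length-map suc e) l) (trans (distinct-map-suc e) d)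

good-map-suc⁻ : ∀ {h n k} e → Good (suc h) n k (map suc e) → Good h n k e
good-map-suc⁻ e (good b v l d) = good (bounded-map-suc⁻ e b) (v ∘ valley-map-suc⁺ e)
  (trans (sym (ListP.length-map suc e)) l) (trans (sym (distinct-map-suc e)) d)

-- A first entry shifts all later positions, so the bound changes between `h` and `suc h`; a last
-- entry leaves `h` fixed. The new count is a separate argument because it depends on whether 0
-- occurs in `e`.
good-0∷⁺ : ∀ {h n k k′ e} → distinct (0 ∷ e) ≡ k′ → Good (suc h) n k e → Good h (suc n) k′ (0 ∷ e)
good-0∷⁺ {e = e} d′ (good b v l d) = good (z≤n ∷ b) (v ∘ valley-0∷⁻ e) (cong suc l) d′

good-0∷⁻ : ∀ {h n k e} → Good h (suc n) k (0 ∷ e) → Good (suc h) n (distinct e) e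
good-0∷⁻ (good (_ ∷ b) v l d) = good b (v ∘ inj₂) (ℕP.suc-injective l) refl

good-∷ʳ0⁺ : ∀ {h n k k′ e} → distinct (0 ∷ e) ≡ k′ → Good h n k e → Good h (suc n) k′ (e ∷ʳ 0)
good-∷ʳ0⁺ {e = e} d′ (good b v l d) = good (bounded-∷ʳ⁺ b z≤n) (v ∘ valley-∷ʳ0⁻ e)
  (trans (ListP.length-++ e) (trans (ℕP.+-comm (length e) 1) (cong suc l)))
  (trans (distinct-∷ʳ 0 e) d′)

good-∷ʳ⁻ : ∀ {h n k x} e → Good h (suc n) k (e ∷ʳ x) → Good h n (distinct e) e
good-∷ʳ⁻ e (good b v l d) = good (proj₁ (bounded-∷ʳ⁻ e b)) (v ∘ valley-∷ʳ⁺ e)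
  (ℕP.suc-injective (trans (ℕP.+-comm 1 (length e)) (trans (sym (ListP.length-++ e)) l))) refl

good-cong : ∀ {h n k k′ e} → k ≡ k′ → Good h n k e → Good h n k′ e
good-cong refl g = g

-- Enumeration by removal of zeros

atPred : {A : Set} → (ℕ → List A) → ℕ → List A
atPred f zero    = []
atPred f (suc k) = f k

-- withZero lists the valley-free lists that contain 0, split by whether the
-- first entry is 0 (leadingZero) or not (trailingZero).
mutual
  zeroFree : ℕ → ℕ → ℕ → List (List ℕ)
  zeroFree zero    zero    zero    = [ [] ]
  zeroFree zero    zero    (suc k) = []
  zeroFree zero    (suc n) k       = []
  zeroFree (suc h) n       k       = map (map suc) (valleyFree h n k)

  valleyFree : ℕ → ℕ → ℕ → List (List ℕ)
  valleyFree h n k = zeroFree h n k ++ withZero h n k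

  withZero : ℕ → ℕ → ℕ → List (List ℕ)
  withZero h n k = leadingZero h n k ++ trailingZero h n k

  -- A zero-free remainder has one value fewer, which `atPred` records. Although `h` grows here, `n`
  -- drops, and `zeroFree` lowers `h` at constant `n`: the recursion is lexicographic in (n, h).
  leadingZero : ℕ → ℕ → ℕ → List (List ℕ)
  leadingZero h zero    k = []
  leadingZero h (suc n) k =
    map (0 ∷_) (atPred (zeroFree (suc h) n) k ++ withZero (suc h) n k)

  trailingZero : ℕ → ℕ → ℕ → List (List ℕ)
  trailingZero h zero    k = []
  trailingZero h (suc n) k =
    map (_∷ʳ 0) (atPred (zeroFree⁺ h n) k ++ trailingZero h n k)

  -- Leaves out the empty list, since `[] ∷ʳ 0` starts with 0 and already belongs to `leadingZero`.
  -- This is the -1 in the equation for R.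
  zeroFree⁺ : ℕ → ℕ → ℕ → List (List ℕ)
  zeroFree⁺ h zero    k = []
  zeroFree⁺ h (suc n) k = zeroFree h (suc n) k

∉⇒map-suc : ∀ e → 0 ∉ e → ∃ λ e′ → e ≡ map suc e′
∉⇒map-suc []          _   = [] , refl
∉⇒map-suc (zero ∷ e)  0∉e = contradiction (here refl) 0∉e
∉⇒map-suc (suc x ∷ e) 0∉e = let e′ , eq = ∉⇒map-suc e (0∉e ∘ there) in x ∷ e′ , cong (suc x ∷_) eq

0∉map-suc : ∀ {e} → 0 ∉ map suc e
0∉map-suc p with ∈-map⁻ suc p
... | _ , _ , ()

-- Separates `trailingZero` from `leadingZero`, and is kept when 0 is appended.
data StartsPositive : List ℕ → Set where
  starts : ∀ {x e} → StartsPositive (suc x ∷ e)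

startsPositive-∷ʳ : ∀ {e x} → StartsPositive e → StartsPositive (e ∷ʳ x)
startsPositive-∷ʳ starts = starts

0∉⇒startsPositive : ∀ {n e} → length e ≡ suc n → 0 ∉ e → StartsPositive e
0∉⇒startsPositive {e = zero ∷ _}  _ 0∉e = contradiction (here refl) 0∉e
0∉⇒startsPositive {e = suc _ ∷ _} _ _   = starts

-- Soundness of the enumeration

mutual
  zeroFree-sound : ∀ h n k {e} → e ∈ zeroFree h n k → Good h n k e × 0 ∉ e
  zeroFree-sound zero    zero zero (here refl) = good [] (λ ()) refl refl , λ ()
  zeroFree-sound (suc h) n    k    p with ∈-map⁻ (map suc) p
  ... | e , q , refl = good-map-suc⁺ (valleyFree-sound h n k q) , 0∉map-suc

  valleyFree-sound : ∀ h n k {e} → e ∈ valleyFree h n k → Good h n k e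
  valleyFree-sound h n k p with ∈-++⁻ (zeroFree h n k) p
  ... | inj₁ q = proj₁ (zeroFree-sound h n k q)
  ... | inj₂ q = proj₁ (withZero-sound h n k q)

  withZero-sound : ∀ h n k {e} → e ∈ withZero h n k → Good h n k e × 0 ∈ e
  withZero-sound h n k p with ∈-++⁻ (leadingZero h n k) p
  ... | inj₁ q with leadingZero-sound h n k q
  ...   | g , _ , refl = g , here refl
  withZero-sound h n k p | inj₂ q =
    let g , 0∈e , _ = trailingZero-sound h n k q in g , 0∈e

  leadingZero-sound : ∀ h n k {e} → e ∈ leadingZero h n k →
                      Good h n k e × ∃ λ e′ → e ≡ 0 ∷ e′
  leadingZero-sound h (suc n) k p with ∈-map⁻ (0 ∷_) p
  ... | e , q , refl with ∈-++⁻ (atPred (zeroFree (suc h) n) k) q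
  leadingZero-sound h (suc n) (suc k) p | e , q , refl | inj₁ r =
    let g , 0∉e = zeroFree-sound (suc h) n k r
    in good-0∷⁺ (trans (distinct-∷-∉ 0∉e) (cong suc (Good.dist≡ g))) g , e , refl
  leadingZero-sound h (suc n) k p | e , q , refl | inj₂ r =
    let g , 0∈e = withZero-sound (suc h) n k r
    in good-0∷⁺ (trans (distinct-∷-∈ 0∈e) (Good.dist≡ g)) g , e , refl

  trailingZero-sound : ∀ h n k {e} → e ∈ trailingZero h n k →
                       Good h n k e × 0 ∈ e × StartsPositive e
  trailingZero-sound h (suc n) k p with ∈-map⁻ (_∷ʳ 0) p
  ... | e , q , refl with ∈-++⁻ (atPred (zeroFree⁺ h n) k) q
  trailingZero-sound h (suc n) (suc k) p | e , q , refl | inj₁ r =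
    let g , 0∉e , pos = zeroFree⁺-sound h n k r
    in good-∷ʳ0⁺ (trans (distinct-∷-∉ 0∉e) (cong suc (Good.dist≡ g))) g
       , ∈-++⁺ʳ e (here refl) , startsPositive-∷ʳ pos
  trailingZero-sound h (suc n) k p | e , q , refl | inj₂ r =
    let g , 0∈e , pos = trailingZero-sound h n k r
    in good-∷ʳ0⁺ (trans (distinct-∷-∈ 0∈e) (Good.dist≡ g)) g
       , ∈-++⁺ʳ e (here refl) , startsPositive-∷ʳ pos

  zeroFree⁺-sound : ∀ h n k {e} → e ∈ zeroFree⁺ h n k →
                    Good h n k e × 0 ∉ e × StartsPositive e
  zeroFree⁺-sound h (suc n) k p =
    let g , 0∉e = zeroFree-sound h (suc n) k p
    in g , 0∉e , 0∉⇒startsPositive (Good.len g) 0∉e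

-- Completeness of the enumeration

mutual
  zeroFree-complete : ∀ h n k {e} → Good h n k e → 0 ∉ e → e ∈ zeroFree h n k
  zeroFree-complete zero .0 .0 {[]} (good _ _ refl refl) _ = here refl
  zeroFree-complete zero n k {zero ∷ e} _ 0∉e = contradiction (here refl) 0∉e
  zeroFree-complete zero n k {suc x ∷ e} (good (() ∷ _) _ _ _) _
  zeroFree-complete (suc h) n k {e} g 0∉e with ∉⇒map-suc e 0∉e
  ... | e′ , refl = ∈-map⁺ (map suc) (valleyFree-complete h n k (good-map-suc⁻ e′ g))

  valleyFree-complete : ∀ h n k {e} → Good h n k e → e ∈ valleyFree h n k
  valleyFree-complete h n k {e} g with 0 ∈? e
  ... | yes 0∈e = ∈-++⁺ʳ (zeroFree h n k) (withZero-complete h n k g 0∈e)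
  ... | no  0∉e = ∈-++⁺ˡ (zeroFree-complete h n k g 0∉e)

  withZero-complete : ∀ h n k {e} → Good h n k e → 0 ∈ e → e ∈ withZero h n k
  withZero-complete h n k {zero ∷ e}  g _   = ∈-++⁺ˡ (leadingZero-complete h n k g)
  withZero-complete h n k {suc x ∷ e} g 0∈e =
    ∈-++⁺ʳ (leadingZero h n k) (trailingZero-complete h n k g 0∈e)

  leadingZero-complete : ∀ h n k {e} → Good h n k (0 ∷ e) → 0 ∷ e ∈ leadingZero h n k
  leadingZero-complete h zero    k (good _ _ () _)
  leadingZero-complete h (suc n) k {e} g with 0 ∈? e
  ... | yes 0∈e = ∈-map⁺ (0 ∷_) (∈-++⁺ʳ (atPred (zeroFree (suc h) n) k)
          (withZero-complete (suc h) n k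
            (good-cong (trans (sym (distinct-∷-∈ 0∈e)) (Good.dist≡ g)) (good-0∷⁻ g)) 0∈e))
  -- Matching on this equation sets `k` to `suc (distinct e)`, so that `atPred` reduces.
  ... | no 0∉e with trans (sym (distinct-∷-∉ 0∉e)) (Good.dist≡ g)
  ...   | refl = ∈-map⁺ (0 ∷_) (∈-++⁺ˡ
          (zeroFree-complete (suc h) n (distinct e) (good-0∷⁻ g) 0∉e))

  trailingZero-complete : ∀ h n k {x e} → Good h n k (suc x ∷ e) → 0 ∈ suc x ∷ e →
                          suc x ∷ e ∈ trailingZero h n k
  trailingZero-complete h zero    k (good _ _ () _)
  trailingZero-complete h (suc n) k {e = e} g (there 0∈e) with initLast e
  trailingZero-complete h (suc n) k g (there ()) | []
  trailingZero-complete h (suc n) k g (there 0∈e) | e ∷ʳ′ suc y with ∈-++⁻ e 0∈e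
  ... | inj₁ 0∈e′ = contradiction (inj₁ (0∈⇒downUp e 0∈e′)) (Good.noValley g)
  ... | inj₂ (here ())
  ... | inj₂ (there ())
  trailingZero-complete h (suc n) k {x} g (there _) | e ∷ʳ′ zero with 0 ∈? (suc x ∷ e)
  ... | yes 0∈e′ = ∈-map⁺ (_∷ʳ 0) (∈-++⁺ʳ (atPred (zeroFree⁺ h n) k)
          (trailingZero-complete h n k (good-cong
            (trans (sym (distinct-∷-∈ 0∈e′)) (trans (sym (distinct-∷ʳ 0 (suc x ∷ e))) (Good.dist≡ g)))
            (good-∷ʳ⁻ (suc x ∷ e) g)) 0∈e′))
  ... | no 0∉e′
    with trans (sym (distinct-∷-∉ 0∉e′)) (trans (sym (distinct-∷ʳ 0 (suc x ∷ e))) (Good.dist≡ g))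
  ...   | refl = ∈-map⁺ (_∷ʳ 0) (∈-++⁺ˡ
          (zeroFree⁺-complete h n (distinct (suc x ∷ e)) (good-∷ʳ⁻ (suc x ∷ e) g) 0∉e′))

  zeroFree⁺-complete : ∀ h n k {x e} → Good h n k (x ∷ e) → 0 ∉ x ∷ e →
                       x ∷ e ∈ zeroFree⁺ h n k
  zeroFree⁺-complete h zero    k (good _ _ () _)
  zeroFree⁺-complete h (suc n) k g 0∉ = zeroFree-complete h (suc n) k g 0∉

-- Absence of repetitions

unique-atPred : ∀ {A : Set} {f : ℕ → List A} → (∀ k → Unique (f k)) → ∀ k → Unique (atPred f k)
unique-atPred f! zero    = []
unique-atPred f! (suc k) = f! k

∈-atPred⁻ : ∀ {A : Set} {f : ℕ → List A} {x} k → x ∈ atPred f k → ∃ λ k′ → x ∈ f k′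
∈-atPred⁻ (suc k) p = k , p

mutual
  zeroFree-unique : ∀ h n k → Unique (zeroFree h n k)
  zeroFree-unique zero    zero    zero    = All.[] ∷ []
  zeroFree-unique zero    zero    (suc k) = []
  zeroFree-unique zero    (suc n) k       = []
  zeroFree-unique (suc h) n       k       =
    UniqueP.map⁺ (ListP.map-injective ℕP.suc-injective) (valleyFree-unique h n k)

  -- The lists are built by injective maps and concatenations. Soundness keeps the concatenated
  -- parts disjoint: by the presence of 0, or, inside `withZero`, by the first entry.
  valleyFree-unique : ∀ h n k → Unique (valleyFree h n k)
  valleyFree-unique h n k = UniqueP.++⁺ (zeroFree-unique h n k) (withZero-unique h n k)
    λ (p , q) → proj₂ (zeroFree-sound h n k p) (proj₂ (withZero-sound h n k q))

  withZero-unique : ∀ h n k → Unique (withZero h n k)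
  withZero-unique h n k = UniqueP.++⁺ (leadingZero-unique h n k) (trailingZero-unique h n k) disjoint
    where
    disjoint : ∀ {e} → ¬ (e ∈ leadingZero h n k × e ∈ trailingZero h n k)
    disjoint (p , q) with leadingZero-sound h n k p | trailingZero-sound h n k q
    ... | _ , _ , refl | _ , _ , ()

  leadingZero-unique : ∀ h n k → Unique (leadingZero h n k)
  leadingZero-unique h zero    k = []
  leadingZero-unique h (suc n) k = UniqueP.map⁺ ListP.∷-injectiveʳ
    (UniqueP.++⁺ (unique-atPred (zeroFree-unique (suc h) n) k) (withZero-unique (suc h) n k)
      λ (p , q) → let k′ , p′ = ∈-atPred⁻ k p in
        proj₂ (zeroFree-sound (suc h) n k′ p′) (proj₂ (withZero-sound (suc h) n k q)))

  trailingZero-unique : ∀ h n k → Unique (trailingZero h n k)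
  trailingZero-unique h zero    k = []
  trailingZero-unique h (suc n) k = UniqueP.map⁺ (ListP.∷ʳ-injectiveˡ _ _)
    (UniqueP.++⁺ (unique-atPred (zeroFree⁺-unique h n) k) (trailingZero-unique h n k)
      λ (p , q) → let k′ , p′ = ∈-atPred⁻ k p in
        proj₁ (proj₂ (zeroFree⁺-sound h n k′ p′)) (proj₁ (proj₂ (trailingZero-sound h n k q))))

  zeroFree⁺-unique : ∀ h n k → Unique (zeroFree⁺ h n k)
  zeroFree⁺-unique h zero    k = []
  zeroFree⁺-unique h (suc n) k = zeroFree-unique h (suc n) k

-- Comparison with inversion sequences stored as vectors

any-lookup⁺ : ∀ {P : ℕ → Set} {n} (e : Vec ℕ n) k → P (lookup e k) → Any P (toList e)
any-lookup⁺ (x ∷ e) Fin.zero    p = here p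
any-lookup⁺ (x ∷ e) (Fin.suc k) p = there (any-lookup⁺ e k p)

any-lookup⁻ : ∀ {P : ℕ → Set} {n} (e : Vec ℕ n) → Any P (toList e) → ∃ λ k → P (lookup e k)
any-lookup⁻ (x ∷ e) (here p)  = Fin.zero , p
any-lookup⁻ (x ∷ e) (there p) = let k , q = any-lookup⁻ e p in Fin.suc k , q

downUp-lookup⁺ : ∀ {a n} (e : Vec ℕ n) j k → j Fin.< k →
  lookup e j < a → lookup e j < lookup e k → DownUp a (toList e)
downUp-lookup⁺ (b ∷ e) Fin.zero    (Fin.suc k) _         b<a p = inj₁ (b<a , any-lookup⁺ e k p)
downUp-lookup⁺ (b ∷ e) (Fin.suc j) (Fin.suc k) (s≤s j<k) q   p = inj₂ (downUp-lookup⁺ e j k j<k q p)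

downUp-lookup⁻ : ∀ {a n} (e : Vec ℕ n) → DownUp a (toList e) →
  ∃ λ j → ∃ λ k → j Fin.< k × lookup e j < a × lookup e j < lookup e k
downUp-lookup⁻ (b ∷ e) (inj₁ (b<a , p)) =
  let k , q = any-lookup⁻ e p in Fin.zero , Fin.suc k , z<s , b<a , q
downUp-lookup⁻ (b ∷ e) (inj₂ p) =
  let j , k , j<k , q = downUp-lookup⁻ e p in Fin.suc j , Fin.suc k , s<s j<k , q

hasPattern⇒valley : ∀ {n} (e : Vec ℕ n) → HasPattern e → Valley (toList e)
hasPattern⇒valley (a ∷ e) (Fin.zero , Fin.suc j , Fin.suc k , _ , s≤s j<k , p , q) =
  inj₁ (downUp-lookup⁺ e j k j<k p q)
hasPattern⇒valley (a ∷ e) (Fin.suc i , Fin.suc j , Fin.suc k , s≤s i<j , s≤s j<k , p) =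
  inj₂ (hasPattern⇒valley e (i , j , k , i<j , j<k , p))

valley⇒hasPattern : ∀ {n} (e : Vec ℕ n) → Valley (toList e) → HasPattern e
valley⇒hasPattern (a ∷ e) (inj₁ p) =
  let j , k , j<k , q = downUp-lookup⁻ e p
  in Fin.zero , Fin.suc j , Fin.suc k , z<s , s<s j<k , q
valley⇒hasPattern (a ∷ e) (inj₂ p) =
  let i , j , k , i<j , j<k , q = valley⇒hasPattern e p
  in Fin.suc i , Fin.suc j , Fin.suc k , s<s i<j , s<s j<k , q

-- In this form the general facts on membership and uniqueness in a product apply.
invSeqs-suc : ∀ n → invSeqs (suc n) ≡ cartesianProductWith Vec._∷ʳ_ (invSeqs n) (upTo (suc n))
invSeqs-suc n = go (invSeqs n)
  where
  go : ∀ es → List.concatMap (λ e → map (e Vec.∷ʳ_) (upTo (suc n))) es ≡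
              cartesianProductWith Vec._∷ʳ_ es (upTo (suc n))
  go []       = refl
  go (e ∷ es) = cong (map (e Vec.∷ʳ_) (upTo (suc n)) ++_) (go es)

invSeqs-unique : ∀ n → Unique (invSeqs n)
invSeqs-unique zero    = All.[] ∷ []
invSeqs-unique (suc n) = subst Unique (sym (invSeqs-suc n))
  (UniqueP.cartesianProductWith⁺ Vec._∷ʳ_ (VecP.∷ʳ-injective _ _)
    (invSeqs-unique n) (UniqueP.upTo⁺ (suc n)))

∈-invSeqs⁻ : ∀ n {e} → e ∈ invSeqs n → Bounded 0 (toList e)
∈-invSeqs⁻ zero    {[]} _ = []
∈-invSeqs⁻ (suc n) {v} p
  with ∈-cartesianProductWith⁻ Vec._∷ʳ_ (invSeqs n) (upTo (suc n)) (subst (v ∈_) (invSeqs-suc n) p)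
... | e , x , e∈ , x∈ , refl = subst (Bounded 0) (sym (VecP.toList-∷ʳ x e))
  (bounded-∷ʳ⁺ (∈-invSeqs⁻ n e∈)
    (subst (x ≤_) (sym (VecP.length-toList e)) (ℕP.≤-pred (∈-upTo⁻ x∈))))

∈-invSeqs⁺ : ∀ n {e} → Bounded 0 (toList e) → e ∈ invSeqs n
∈-invSeqs⁺ zero    {[]} _ = here refl
∈-invSeqs⁺ (suc n) {e} b with Vec.initLast e
... | e′ , x , refl with bounded-∷ʳ⁻ (toList e′) (subst (Bounded 0) (VecP.toList-∷ʳ x e′) b)
...   | b′ , x≤ = subst (e′ Vec.∷ʳ x ∈_) (sym (invSeqs-suc n))
  (∈-cartesianProductWith⁺ Vec._∷ʳ_ (∈-invSeqs⁺ n b′)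
    (∈-upTo⁺ (s≤s (subst (x ≤_) (VecP.length-toList e′) x≤))))

-- Both sides count duplicate-free lists and `toList` is injective, so equality of the underlying
-- sets suffices. Completeness and soundness at h = 0 give the two inclusions.
coeffB≡length : ∀ n k → coeffB n k ≡ length (valleyFree 0 n k)
coeffB≡length n k = trans (sym (ListP.length-map toList B))
  (unique-set⇒length
    (UniqueP.map⁺ (λ {e} {e′} eq → trans (sym (VecP.cast-is-id refl e)) (VecP.toList-injective refl e e′ eq))
      (UniqueP.filter⁺ P? (invSeqs-unique n)))
    (valleyFree-unique 0 n k) (mk⇔ to from))
  where
  P? = λ (e : Vec ℕ n) → inB? e ×-dec (dist e ℕP.≟ k)
  B : List (Vec ℕ n)
  B = filter P? (invSeqs n)
  to : ∀ {e} → e ∈ map toList B → e ∈ valleyFree 0 n k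
  to p with ∈-map⁻ toList p
  ... | e , q , refl with ∈-filter⁻ P? {xs = invSeqs n} q
  ...   | e∈ , inB , d = valleyFree-complete 0 n k
    (good (∈-invSeqs⁻ n e∈) (inB ∘ valley⇒hasPattern e) (VecP.length-toList e) d)
  from : ∀ {e} → e ∈ valleyFree 0 n k → e ∈ map toList B
  from {e} p with valleyFree-sound 0 n k p
  ... | good b v refl d = subst (_∈ map toList B) (VecP.toList∘fromList e)
    (∈-map⁺ toList (∈-filter⁺ P?
      (∈-invSeqs⁺ n (subst (Bounded 0) (sym (VecP.toList∘fromList e)) b))
      ( (λ pat → v (subst Valley (VecP.toList∘fromList e) (hasPattern⇒valley (Vec.fromList e) pat)))
      , trans (cong distinct (VecP.toList∘fromList e)) d)))

-- Generating functions

z-contraction : (D : ℕ → Series) → D 0 ≗ₛ 0ₛ → (a b c : Series) →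
  (∀ h → D (1 ℕ.+ h) ≗ₛ D h ⊕ Z ⊛ (a ⊛ D h ⊕ b ⊛ D (1 ℕ.+ h) ⊕ c ⊛ D (2 ℕ.+ h))) →
  ∀ h → D h ≗ₛ 0ₛ
z-contraction D D₀≈0 a b c step h n k = vanishes (suc n) h n ℕP.≤-refl k
  where
  -- Every `D h` lies in (zⁿ), by induction on n and then on h: `step` uses the preceding term at
  -- the same n, but the bracket only at n - 1, thanks to the factor `Z`; this covers the higher
  -- indices in it.
  vanishes : ∀ n h → Vanishes n (D h)
  vanishes zero    h       m ()
  vanishes (suc n) zero    m _   k = D₀≈0 m k
  vanishes (suc n) (suc h) m m<n k = trans (step h m k)
    (vanishes-⊕ {f = D h} (vanishes (suc n) h)
      (vanishes-Z⊛ {f = a ⊛ D h ⊕ b ⊛ D (suc h) ⊕ c ⊛ D (suc (suc h))}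
        (vanishes-⊕ {f = a ⊛ D h ⊕ b ⊛ D (suc h)}
          (vanishes-⊕ {f = a ⊛ D h}
            (vanishes-⊛ a (vanishes n h)) (vanishes-⊛ b (vanishes n (suc h))))
          (vanishes-⊛ c (vanishes n (suc (suc h))))))
      m m<n k)

counts : (ℕ → ℕ → List (List ℕ)) → Series
counts L n k = + length (L n k)

N P R : ℕ → Series
N h = counts (zeroFree h)
P h = counts (leadingZero h)
R h = counts (trailingZero h)

-- `atPred` is multiplication by t at the level of lists.
T-⊛-counts : ∀ L n k → (T ⊛ counts L) n k ≡ + length (atPred (L n) k)
T-⊛-counts L n zero    = T-⊛-zero (counts L) n
T-⊛-counts L n (suc k) = T-⊛-suc (counts L) n k

N-zero : N 0 ≗ₛ const (+ 1)
N-zero zero    zero    = refl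
N-zero zero    (suc k) = refl
N-zero (suc n) k       = refl

N-suc-withZero : ∀ h n k → N (suc h) n k ≡ N h n k ℤ.+ + length (withZero h n k)
N-suc-withZero h n k = cong +_
  (trans (ListP.length-map (map suc) (valleyFree h n k)) (ListP.length-++ (zeroFree h n k)))

N-suc : ∀ h → N (suc h) ≗ₛ N h ⊕ (P h ⊕ R h)
N-suc h n k = trans (N-suc-withZero h n k)
  (cong (λ l → N h n k ℤ.+ + l) (ListP.length-++ (leadingZero h n k)))

-- Deleting the leading 0 leaves a zero-free list, which contributes t N_{h+1}, or one with a 0,
-- counted by N_{h+2} - N_{h+1}. The negative term is moved to the left.
P-eq : ∀ h → P h ⊕ Z ⊛ N (1 ℕ.+ h) ≗ₛ Z ⊛ (T ⊛ N (1 ℕ.+ h) ⊕ N (2 ℕ.+ h))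
P-eq h zero k = trans (cong (ℤ._+_ (+ 0)) (Z-⊛-zero (N (1 ℕ.+ h)) k))
  (sym (Z-⊛-zero (T ⊛ N (1 ℕ.+ h) ⊕ N (2 ℕ.+ h)) k))
P-eq h (suc n) k = begin
  P h (suc n) k ℤ.+ (Z ⊛ N (1 ℕ.+ h)) (suc n) k
    ≡⟨ cong₂ ℤ._+_
         (cong +_ (trans (ListP.length-map (0 ∷_) (A ++ W)) (ListP.length-++ A)))
         (Z-⊛-suc (N (1 ℕ.+ h)) n k) ⟩
  (+ length A ℤ.+ + length W) ℤ.+ N (1 ℕ.+ h) n k
    ≡⟨ ℤP.+-assoc (+ length A) (+ length W) (N (1 ℕ.+ h) n k) ⟩
  + length A ℤ.+ (+ length W ℤ.+ N (1 ℕ.+ h) n k)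
    ≡⟨ cong₂ ℤ._+_ (sym (T-⊛-counts (zeroFree (1 ℕ.+ h)) n k))
         (trans (ℤP.+-comm (+ length W) (N (1 ℕ.+ h) n k)) (sym (N-suc-withZero (1 ℕ.+ h) n k))) ⟩
  (T ⊛ N (1 ℕ.+ h) ⊕ N (2 ℕ.+ h)) n k
    ≡⟨ Z-⊛-suc (T ⊛ N (1 ℕ.+ h) ⊕ N (2 ℕ.+ h)) n k ⟨
  (Z ⊛ (T ⊛ N (1 ℕ.+ h) ⊕ N (2 ℕ.+ h))) (suc n) k ∎
  where
  open ≡-Reasoning
  A W : List (List ℕ)
  A = atPred (zeroFree (1 ℕ.+ h) n) k
  W = withZero (1 ℕ.+ h) n k

N-coeff₀ : ∀ h k → N h 0 k ≡ const (+ 1) 0 k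
N-coeff₀ zero    k = N-zero 0 k
N-coeff₀ (suc h) k = trans (N-suc-withZero h 0 k)
  (trans (ℤP.+-identityʳ (N h 0 k)) (N-coeff₀ h k))

-- The constant term of `N h` in z is 1, from the empty list, so omitting that list lowers t N_h by
-- t.
zeroFree⁺+T : ∀ h n k →
  + length (atPred (zeroFree⁺ h n) k) ℤ.+ T n k ≡ + length (atPred (zeroFree h n) k)
zeroFree⁺+T h zero    zero          = refl
zeroFree⁺+T h zero    (suc zero)    = sym (N-coeff₀ h 0)
zeroFree⁺+T h zero    (suc (suc k)) = sym (N-coeff₀ h (suc k))
zeroFree⁺+T h (suc n) zero          = refl
zeroFree⁺+T h (suc n) (suc k)       = ℤP.+-identityʳ (N h (suc n) k)

-- Deleting the last 0 leaves a nonempty zero-free list or a shorter list of the same kind, with `h`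
-- unchanged. `Z ⊛ T` makes up for the omitted empty list.
R-eq : ∀ h → R h ⊕ Z ⊛ T ≗ₛ Z ⊛ (T ⊛ N h ⊕ R h)
R-eq h zero k = trans (cong (ℤ._+_ (+ 0)) (Z-⊛-zero T k))
  (sym (Z-⊛-zero (T ⊛ N h ⊕ R h) k))
R-eq h (suc n) k = begin
  R h (suc n) k ℤ.+ (Z ⊛ T) (suc n) k
    ≡⟨ cong₂ ℤ._+_
         (cong +_ (trans (ListP.length-map (_∷ʳ 0) (A ++ B)) (ListP.length-++ A)))
         (Z-⊛-suc T n k) ⟩
  (+ length A ℤ.+ + length B) ℤ.+ T n k
    ≡⟨ ℤP.+-assoc (+ length A) (+ length B) (T n k) ⟩
  + length A ℤ.+ (+ length B ℤ.+ T n k)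
    ≡⟨ cong (ℤ._+_ (+ length A)) (ℤP.+-comm (+ length B) (T n k)) ⟩
  + length A ℤ.+ (T n k ℤ.+ + length B)
    ≡⟨ ℤP.+-assoc (+ length A) (T n k) (+ length B) ⟨
  (+ length A ℤ.+ T n k) ℤ.+ + length B
    ≡⟨ cong (ℤ._+ + length B)
         (trans (zeroFree⁺+T h n k) (sym (T-⊛-counts (zeroFree h) n k))) ⟩
  (T ⊛ N h ⊕ R h) n k
    ≡⟨ Z-⊛-suc (T ⊛ N h ⊕ R h) n k ⟨
  (Z ⊛ (T ⊛ N h ⊕ R h)) (suc n) k ∎
  where
  open ≡-Reasoning
  A B : List (List ℕ)
  A = atPred (zeroFree⁺ h n) k
  B = trailingZero h n k

FB≗N₁ : FB ≗ₛ N 1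
FB≗N₁ n k = cong +_ (trans (coeffB≡length n k)
  (sym (ListP.length-map (map suc) (valleyFree 0 n k))))

module SeriesKernel = Kernel seriesRing constMorphism Z T
module Solution = SeriesKernel.Geometric z-contraction N P R N-zero N-suc P-eq R-eq

theorem5p3 : ∃ λ (S : Series) →
    (S 0 0 ≡ + 1) × (S ⊛ S ≗ₛ radQ) × (denom ⊛ FB ≗ₛ numP ⊖ S)
theorem5p3 =
  -- The witness is 1 - z times the square root in the formula, as `radQ` is the radicand times (1 -
  -- z)². Its constant coefficient 1, which selects the branch, is found by computation.
  Solution.root , refl , Solution.root² ,
  λ n k → trans (S.*-congˡ {denom} FB≗N₁ n k) (Solution.d*N₁≈p-root n k)
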